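{- We have $\beta > 0.72195$; that is, there exists a set of positive integers having an asymptotic density greater than $0.72195$ which contains no three-term geometric progression with integer ratio.
   Context: A three-term geometric progression with integer ratio is a triple $(a, ak, ak^2)$ of positive integers with $k \geq 2$ an integer. $\beta$ is the supremum of the asymptotic densities $d(A)$ over all sets $A\subset\mathbb{N}$ that contain no three-term geometric progression with integer ratio and whose asymptotic density $d(A)=\lim_{N\to\infty}|A\cap\{1,\dots,N\}|/N$ exists. -}

module Defs where

open import Data.Nat using (ℕ; zero; suc; _+_; _*_; _≤_)
open import Data.Bool using (Bool; true; false; if_then_else_)
open import Data.Integer using (+_)
open import Data.Rational using (ℚ; _/_; _-_; ∣_∣; 0ℚ) renaming (_≤_ to _≤ℚ_; _<_ to _<ℚ_)
open import Data.Product using (_×_; ∃-syntax)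
open import Relation.Binary.PropositionalEquality using (_≡_)
open import Relation.Nullary using (¬_)

-- A set of positive integers, given by its characteristic function.
-- The value at 0 is irrelevant (only 1,2,3,... are ever inspected).
PosSet : Set
PosSet = ℕ → Bool

count : PosSet → ℕ → ℕ
count A zero = 0
count A (suc n) = count A n + (if A (suc n) then 1 else 0)

-- ratio A n = |A ∩ {1,…,n+1}| / (n+1)   (shifted index to avoid division by 0)
ratio : PosSet → ℕ → ℚ
ratio A n = (+ count A (suc n)) / suc n

NoGP3 : PosSet → Set
NoGP3 A = ∀ (a k : ℕ) → 1 ≤ a → 2 ≤ k →
  ¬ (A a ≡ true × A (a * k) ≡ true × A (a * k * k) ≡ true)

-- The asymptotic density of A exists: the sequence |A ∩ [1,N]|/N is Cauchy
-- (equivalently, convergent in ℝ).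
DensityExists : PosSet → Set
DensityExists A = ∀ (ε : ℚ) → 0ℚ <ℚ ε →
  ∃[ N₀ ] (∀ m n → N₀ ≤ m → N₀ ≤ n → ∣ ratio A m - ratio A n ∣ ≤ℚ ε)

-- Given that the density exists, d(A) > c iff the ratios are eventually
-- bounded below by some rational q > c.
DensityGreaterThan : PosSet → ℚ → Set
DensityGreaterThan A c = ∃[ q ] (c <ℚ q × ∃[ N₀ ] (∀ n → N₀ ≤ n → q ≤ℚ ratio A n))

{-# OPTIONS --safe #-}

-- The set consists of the products t m with t in a finite set of 11-smooth numbers without
-- geometric progressions and m squarefree and coprime to 2310. In a progression of products
-- (a, ak, ak²), coprimality splits off progressions in t and in m; the one in m is
-- constant since its third term is divisible by the square of the ratio, so the one in t is
-- nontrivial. Rankin's set corresponds to t with exponents free of arithmetic progressions;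
-- the gain comes from omitting numbers such as 30 and keeping others in exchange.
--
-- The moduli 2, 3, 5, 7, 11, 13², 17², … are pairwise coprime, so sieving by another modulus s
-- changes the counting function from f(N) to f(N) − f(N/s), which keeps it linear up to
-- a bounded error; stopping at M costs at most ∑_{d > M} N/d² ≤ N/M.
module Submission where

open import Defs
open import Data.Bool using (Bool; true; false; if_then_else_; not; _∧_; _∨_; T)
open import Data.Bool.ListAction using (all)
open import Data.Bool.Properties using (T-∨)
open import Data.Integer using (+_; -[1+_]; +[1+_])
import Data.Integer as ℤ
import Data.Integer.Properties as ℤ
open import Data.List.Base using (List; []; _∷_)
open import Data.List.Membership.Propositional using (_∈_)
open import Data.List.Relation.Unary.All as All using (All; []; _∷_; all?)
open import Data.List.Relation.Unary.All.Properties using (all⁺)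
open import Data.List.Relation.Unary.AllPairs using ([]; _∷_)
open import Data.List.Relation.Unary.Any using (here; there)
open import Data.List.Relation.Unary.Unique.Propositional using (Unique)
open import Data.Nat hiding (_/_)
open import Data.Nat.Coprimality as Coprimality using (Coprime; coprime-divisor; prime⇒coprime)
open import Data.Nat.Divisibility
import Data.Nat.DivMod as ℕ
open import Data.Nat.Primality
open import Data.Nat.Primality.Factorisation using (factorise)
open import Data.Nat.Properties
open import Data.Nat.Tactic.RingSolver using (solve-∀)
open import Data.List.Relation.Unary.Unique.DecPropositional _≟_ using (unique?)
open import Data.Product using (_×_; _,_; ∃-syntax; proj₁; proj₂)
open import Data.Rational using (mkℚ; 0ℚ; toℚᵘ; ∣_∣; _/_)
  renaming (_≤_ to _≤ℚ_; _<_ to _<ℚ_; _-_ to _-ℚ_; _+_ to _+ℚ_; -_ to -ℚ_)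
import Data.Rational.Properties as ℚ
open import Data.Rational.Unnormalised using (mkℚᵘ; *≤*)
import Data.Rational.Unnormalised as ℚᵘ
import Data.Rational.Unnormalised.Properties as ℚᵘ
open import Data.Sum using (_⊎_; inj₁; inj₂)
open import Function using (_∘_)
open import Function.Bundles using (Equivalence)
open import Relation.Binary.PropositionalEquality
open import Relation.Nullary using (Dec; yes; no; does; ¬_; contradiction)
open import Relation.Nullary.Decidable using (from-yes)

-- Counting functions and dilates of sets.

indicator : Bool → ℕ
indicator b = if b then 1 else 0

count-cong : ∀ {A B : PosSet} N → (∀ n → 1 ≤ n → n ≤ N → A n ≡ B n) → count A N ≡ count B N
count-cong zero _ = refl
count-cong (suc N) A≗B =
  cong₂ _+_ (count-cong N (λ n 1≤n n≤N → A≗B n 1≤n (m≤n⇒m≤1+n n≤N)))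
            (cong indicator (A≗B (suc N) z<s ≤-refl))

count-+ : ∀ {A B C : PosSet} →
          (∀ n → 1 ≤ n → indicator (A n) ≡ indicator (B n) + indicator (C n)) →
          ∀ N → count A N ≡ count B N + count C N
count-+ A≗B+C zero = refl
count-+ {A} {B} {C} A≗B+C (suc N) = begin
  count A N + indicator (A (suc N))
    ≡⟨ cong₂ _+_ (count-+ {A} {B} {C} A≗B+C N) (A≗B+C (suc N) z<s) ⟩
  count B N + count C N + (indicator (B (suc N)) + indicator (C (suc N)))
    ≡⟨ lemma (count B N) (count C N) (indicator (B (suc N))) (indicator (C (suc N))) ⟩
  count B N + indicator (B (suc N)) + (count C N + indicator (C (suc N))) ∎
  where
  open ≡-Reasoning
  lemma : ∀ b c x y → b + c + (x + y) ≡ b + x + (c + y)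
  lemma = solve-∀

count-mono : ∀ {A B : PosSet} → (∀ n → 1 ≤ n → A n ≡ true → B n ≡ true) →
             ∀ N → count A N ≤ count B N
count-mono A⊆B zero = z≤n
count-mono {A} {B} A⊆B (suc N) = +-mono-≤ (count-mono {A} {B} A⊆B N) step
  where
  step : indicator (A (suc N)) ≤ indicator (B (suc N))
  step with A (suc N) in eq
  ... | false = z≤n
  ... | true rewrite A⊆B (suc N) z<s eq = ≤-refl

count≤ : ∀ (A : PosSet) N → count A N ≤ N
count≤ A zero = z≤n
count≤ A (suc N) = begin
  count A N + indicator (A (suc N)) ≤⟨ +-mono-≤ (count≤ A N) (indicator≤1 (A (suc N))) ⟩
  N + 1                             ≡⟨ +-comm N 1 ⟩
  suc N                             ∎
  where
  open ≤-Reasoning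
  indicator≤1 : ∀ b → indicator b ≤ 1
  indicator≤1 true  = ≤-refl
  indicator≤1 false = z≤n

count-∅ : ∀ N → count (λ _ → false) N ≡ 0
count-∅ zero = refl
count-∅ (suc N) = cong (_+ 0) (count-∅ N)

dilate : ℕ → PosSet → PosSet
dilate t P n with t ∣? n
... | yes t∣n = P (quotient t∣n)
... | no  _   = false

dilate-* : ∀ t P q .{{_ : NonZero t}} → dilate t P (q * t) ≡ P q
dilate-* t P q with t ∣? q * t
... | yes (divides r eq) = cong P (*-cancelʳ-≡ r q t (sym eq))
... | no  t∤qt = contradiction (divides q refl) t∤qt

dilate-∤ : ∀ {t n} P → t ∤ n → dilate t P n ≡ false
dilate-∤ {t} {n} P t∤n with t ∣? n
... | yes t∣n = contradiction t∣n t∤n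
... | no  _   = refl

dilate-true : ∀ {t n} P → dilate t P n ≡ true → ∃[ q ] (n ≡ q * t × P q ≡ true)
dilate-true {t} {n} P h with t ∣? n
... | yes (divides q eq) = q , eq , h

-- Writing the bound as `r + q * t` lets the induction descend one integer at a time: a step in `r`
-- meets a nonmultiple of `t`, and at remainder 0 the step meets the `q`-th multiple and continues
-- from remainder `t − 1`.
count-dilate : ∀ t P r q → r < t → count (dilate t P) (r + q * t) ≡ count P q
count-dilate t P zero zero _ = refl
count-dilate (suc t) P zero (suc q) _ =
  cong₂ _+_ (count-dilate (suc t) P t q ≤-refl) (cong indicator (dilate-* (suc t) P (suc q)))
count-dilate t P (suc r) q r<t = begin
  count (dilate t P) (r + q * t) + indicator (dilate t P (suc r + q * t))
    ≡⟨ cong₂ _+_ (count-dilate t P r q (<-trans (n<1+n r) r<t))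
                 (cong indicator (dilate-∤ P t∤)) ⟩
  count P q + 0
    ≡⟨ +-identityʳ _ ⟩
  count P q ∎
  where
  open ≡-Reasoning
  t∤ : t ∤ suc r + q * t
  t∤ t∣ = >⇒∤ r<t (∣m+n∣m⇒∣n (subst (t ∣_) (+-comm (suc r) (q * t)) t∣) (n∣m*n q))

divMod : ∀ N t .{{_ : NonZero t}} → ∃[ r ] ∃[ q ] (r < t × N ≡ r + q * t)
divMod N t = N ℕ.% t , N ℕ./ t , ℕ.m%n<n N t , ℕ.m≡m%n+[m/n]*n N t

-- Linear approximation of counting functions.

-- f N / N lies between (a − w) / d and a / d up to O(1 / N).
record Approx (f : ℕ → ℕ) (a d w : ℕ) : Set where
  field
    c     : ℕ
    lower : ∀ N → a * N ≤ d * f N + (w * N + c)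
    upper : ∀ N → d * f N ≤ a * N + c

approx-id : Approx (λ N → N) 1 1 0
approx-id = record { c = 0 ; lower = λ N → m≤m+n (1 * N) 0 ; upper = λ N → m≤m+n (1 * N) 0 }

approx-0 : ∀ {f} → (∀ N → f N ≡ 0) → ∀ d → Approx f 0 d 0
approx-0 {f} f≡0 d = record
  { c     = 0
  ; lower = λ N → z≤n
  ; upper = λ N → ≤-reflexive (trans (cong (d *_) (f≡0 N)) (*-zeroʳ d))
  }

approx-cong : ∀ {f g a d w} → (∀ N → f N ≡ g N) → Approx f a d w → Approx g a d w
approx-cong {f} {g} {a} {d} {w} f≡g F = record
  { c     = c
  ; lower = λ N → subst (λ x → a * N ≤ d * x + (w * N + c)) (f≡g N) (lower N)
  ; upper = λ N → subst (λ x → d * x ≤ a * N + c) (f≡g N) (upper N)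
  }
  where open Approx F

approx-+ : ∀ {f g h a b d v w} → (∀ N → h N ≡ f N + g N) →
           Approx f a d v → Approx g b d w → Approx h (a + b) d (v + w)
approx-+ {f} {g} {h} {a} {b} {d} {v} {w} h≡f+g F G = record
  { c = F.c + G.c ; lower = low ; upper = upp }
  where
  module F = Approx F
  module G = Approx G
  open ≤-Reasoning
  low : ∀ N → (a + b) * N ≤ d * h N + ((v + w) * N + (F.c + G.c))
  low N rewrite h≡f+g N = begin
    (a + b) * N   ≡⟨ *-distribʳ-+ N a b ⟩
    a * N + b * N ≤⟨ +-mono-≤ (F.lower N) (G.lower N) ⟩
    d * f N + (v * N + F.c) + (d * g N + (w * N + G.c))
      ≡⟨ lemma d v w N F.c G.c (f N) (g N) ⟩
    d * (f N + g N) + ((v + w) * N + (F.c + G.c)) ∎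
    where
    lemma : ∀ d v w N k l x y → d * x + (v * N + k) + (d * y + (w * N + l)) ≡
                                d * (x + y) + ((v + w) * N + (k + l))
    lemma = solve-∀
  upp : ∀ N → d * h N ≤ (a + b) * N + (F.c + G.c)
  upp N rewrite h≡f+g N = begin
    d * (f N + g N)                 ≡⟨ *-distribˡ-+ d (f N) (g N) ⟩
    d * f N + d * g N               ≤⟨ +-mono-≤ (F.upper N) (G.upper N) ⟩
    a * N + F.c + (b * N + G.c)     ≡⟨ lemma a b N F.c G.c ⟩
    (a + b) * N + (F.c + G.c)       ∎
    where
    lemma : ∀ a b N k l → a * N + k + (b * N + l) ≡ (a + b) * N + (k + l)
    lemma = solve-∀

-- Dilation by `t` divides the density by `t`. The free factor `u` expands the fraction, so that
-- dilates by different `t` can share one denominator when `t * u` is a fixed common multiple.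
-- Rounding `N` to a multiple of `t` costs only a constant, absorbed in `c′`.
approx-dilate : ∀ {f h a d w} t u .{{_ : NonZero t}} →
                (∀ r q → r < t → h (r + q * t) ≡ f q) →
                Approx f a d w → Approx h (a * u) (d * (t * u)) (w * u)
approx-dilate {f} {h} {a} {d} {w} t u h≡f F = record
  { c = c′ ; lower = low ; upper = upp }
  where
  open Approx F
  c′ = t * u * c + a * (t * u)
  open ≤-Reasoning
  low : ∀ N → a * u * N ≤ d * (t * u) * h N + (w * u * N + c′)
  low N with divMod N t
  ... | r , q , r<t , refl rewrite h≡f r q r<t = begin
    a * u * (r + q * t)
      ≤⟨ *-monoʳ-≤ (a * u) (+-monoˡ-≤ (q * t) (<⇒≤ r<t)) ⟩
    a * u * (t + q * t)
      ≡⟨ lemma₁ a u q t ⟩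
    t * u * (a * q) + a * (t * u)
      ≤⟨ +-monoˡ-≤ (a * (t * u)) (*-monoʳ-≤ (t * u) (lower q)) ⟩
    t * u * (d * f q + (w * q + c)) + a * (t * u)
      ≡⟨ lemma₂ a u q t d (f q) w c ⟩
    d * (t * u) * f q + (w * u * (q * t) + c′)
      ≤⟨ +-monoʳ-≤ (d * (t * u) * f q) (+-monoˡ-≤ c′ (*-monoʳ-≤ (w * u) (m≤n+m (q * t) r))) ⟩
    d * (t * u) * f q + (w * u * (r + q * t) + c′) ∎
    where
    lemma₁ : ∀ a u q t → a * u * (t + q * t) ≡ t * u * (a * q) + a * (t * u)
    lemma₁ = solve-∀
    lemma₂ : ∀ a u q t d x w c → t * u * (d * x + (w * q + c)) + a * (t * u) ≡
             d * (t * u) * x + (w * u * (q * t) + (t * u * c + a * (t * u)))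
    lemma₂ = solve-∀
  upp : ∀ N → d * (t * u) * h N ≤ a * u * N + c′
  upp N with divMod N t
  ... | r , q , r<t , refl rewrite h≡f r q r<t = begin
    d * (t * u) * f q
      ≡⟨ lemma₁ d t u (f q) ⟩
    t * u * (d * f q)
      ≤⟨ *-monoʳ-≤ (t * u) (upper q) ⟩
    t * u * (a * q + c)
      ≡⟨ lemma₂ t u a q c ⟩
    a * u * (q * t) + t * u * c
      ≤⟨ +-mono-≤ (*-monoʳ-≤ (a * u) (m≤n+m (q * t) r)) (m≤m+n (t * u * c) (a * (t * u))) ⟩
    a * u * (r + q * t) + c′ ∎
    where
    lemma₁ : ∀ d t u x → d * (t * u) * x ≡ t * u * (d * x)
    lemma₁ = solve-∀
    lemma₂ : ∀ t u a q c → t * u * (a * q + c) ≡ a * u * (q * t) + t * u * c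
    lemma₂ = solve-∀

-- Since `q` is `N / suc s` rounded down, removing `f q` multiplies the density by `1 − 1 / suc s`,
-- which is `s / suc s`. Both bounds are proved with `e * N′` added to each side, in place of a
-- subtraction in `ℕ`; each uses the two bounds of `F` once, at `N′` and at `q`.
approx-sieve : ∀ {f g e d} s →
               (∀ r q → r < suc s → f (r + q * suc s) ≡ g (r + q * suc s) + f q) →
               Approx f e d 0 → Approx g (e * s) (d * suc s) 0
approx-sieve {f} {g} {e} {d} s f≡g+f F = record
  { c = c′ ; lower = low ; upper = upp }
  where
  open Approx F
  c′ = 2 * (suc s * c) + e * suc s
  open ≤-Reasoning
  low : ∀ N → e * s * N ≤ d * suc s * g N + c′
  low N with divMod N (suc s)
  ... | r , q , r<s , refl = +-cancelʳ-≤ (e * N′) _ _ (begin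
    e * s * N′ + e * N′
      ≡⟨ lemma₁ e s N′ ⟩
    suc s * (e * N′)
      ≤⟨ *-monoʳ-≤ (suc s) (lower N′) ⟩
    suc s * (d * f N′ + c)
      ≡⟨ cong (λ x → suc s * (d * x + c)) (f≡g+f r q r<s) ⟩
    suc s * (d * (g N′ + f q) + c)
      ≡⟨ lemma₂ s d (g N′) (f q) c ⟩
    d * suc s * g N′ + (suc s * (d * f q) + suc s * c)
      ≤⟨ +-monoʳ-≤ (d * suc s * g N′) (+-monoˡ-≤ (suc s * c) (*-monoʳ-≤ (suc s) (upper q))) ⟩
    d * suc s * g N′ + (suc s * (e * q + c) + suc s * c)
      ≡⟨ lemma₃ (d * suc s * g N′) s e q c ⟩
    d * suc s * g N′ + 2 * (suc s * c) + e * (q * suc s)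
      ≤⟨ +-mono-≤ (+-monoʳ-≤ (d * suc s * g N′) (m≤m+n (2 * (suc s * c)) (e * suc s)))
                  (*-monoʳ-≤ e (m≤n+m (q * suc s) r)) ⟩
    d * suc s * g N′ + c′ + e * N′ ∎)
    where
    N′ = r + q * suc s
    lemma₁ : ∀ e s n → e * s * n + e * n ≡ suc s * (e * n)
    lemma₁ = solve-∀
    lemma₂ : ∀ s d x y c → suc s * (d * (x + y) + c) ≡
                           d * suc s * x + (suc s * (d * y) + suc s * c)
    lemma₂ = solve-∀
    lemma₃ : ∀ x s e q c → x + (suc s * (e * q + c) + suc s * c) ≡
                           x + 2 * (suc s * c) + e * (q * suc s)
    lemma₃ = solve-∀
  upp : ∀ N → d * suc s * g N ≤ e * s * N + c′
  upp N with divMod N (suc s)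
  ... | r , q , r<s , refl = +-cancelʳ-≤ (e * N′) _ _ (begin
    d * suc s * g N′ + e * N′
      ≤⟨ +-monoʳ-≤ (d * suc s * g N′) (*-monoʳ-≤ e (+-monoˡ-≤ (q * suc s) (<⇒≤ r<s))) ⟩
    d * suc s * g N′ + e * (suc s + q * suc s)
      ≡⟨ lemma₁ (d * suc s * g N′) e s q ⟩
    d * suc s * g N′ + suc s * (e * q) + e * suc s
      ≤⟨ +-monoˡ-≤ (e * suc s) (+-monoʳ-≤ (d * suc s * g N′) (*-monoʳ-≤ (suc s) (lower q))) ⟩
    d * suc s * g N′ + suc s * (d * f q + c) + e * suc s
      ≡⟨ lemma₂ d s (g N′) (f q) c (e * suc s) ⟩
    suc s * (d * (g N′ + f q)) + (suc s * c + e * suc s)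
      ≡⟨ cong (λ x → suc s * (d * x) + (suc s * c + e * suc s)) (f≡g+f r q r<s) ⟨
    suc s * (d * f N′) + (suc s * c + e * suc s)
      ≤⟨ +-monoˡ-≤ (suc s * c + e * suc s) (*-monoʳ-≤ (suc s) (upper N′)) ⟩
    suc s * (e * N′ + c) + (suc s * c + e * suc s)
      ≡⟨ lemma₃ s e N′ c ⟩
    e * s * N′ + c′ + e * N′ ∎)
    where
    N′ = r + q * suc s
    lemma₁ : ∀ x e s q → x + e * (suc s + q * suc s) ≡ x + suc s * (e * q) + e * suc s
    lemma₁ = solve-∀
    lemma₂ : ∀ d s x y c z → d * suc s * x + suc s * (d * y + c) + z ≡
                             suc s * (d * (x + y)) + (suc s * c + z)
    lemma₂ = solve-∀
    lemma₃ : ∀ s e n c → suc s * (e * n + c) + (suc s * c + e * suc s) ≡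
                         e * s * n + (2 * (suc s * c) + e * suc s) + e * n
    lemma₃ = solve-∀

-- The count `g` falls short of `f` by at most `N / M`. Over the denominator `M * d` this loss of
-- `1 / M` is `d`, hence the last parameter.
approx-subset : ∀ {f g e d} M → (∀ N → g N ≤ f N) → (∀ N → M * f N ≤ M * g N + N) →
                Approx f e d 0 → Approx g (M * e) (M * d) d
approx-subset {f} {g} {e} {d} M g≤f f≤g F = record
  { c = M * c ; lower = low ; upper = upp }
  where
  open Approx F
  open ≤-Reasoning
  low : ∀ N → M * e * N ≤ M * d * g N + (d * N + M * c)
  low N = begin
    M * e * N                       ≡⟨ *-assoc M e N ⟩
    M * (e * N)                     ≤⟨ *-monoʳ-≤ M (lower N) ⟩
    M * (d * f N + c)               ≡⟨ lemma₁ M d (f N) c ⟩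
    d * (M * f N) + M * c           ≤⟨ +-monoˡ-≤ (M * c) (*-monoʳ-≤ d (f≤g N)) ⟩
    d * (M * g N + N) + M * c       ≡⟨ lemma₂ M d (g N) N c ⟩
    M * d * g N + (d * N + M * c)   ∎
    where
    lemma₁ : ∀ M d x c → M * (d * x + c) ≡ d * (M * x) + M * c
    lemma₁ = solve-∀
    lemma₂ : ∀ M d x n c → d * (M * x + n) + M * c ≡ M * d * x + (d * n + M * c)
    lemma₂ = solve-∀
  upp : ∀ N → M * d * g N ≤ M * e * N + M * c
  upp N = begin
    M * d * g N         ≡⟨ *-assoc M d (g N) ⟩
    M * (d * g N)       ≤⟨ *-monoʳ-≤ M (*-monoʳ-≤ d (g≤f N)) ⟩
    M * (d * f N)       ≤⟨ *-monoʳ-≤ M (upper N) ⟩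
    M * (e * N + c)     ≡⟨ lemma M e N c ⟩
    M * e * N + M * c   ∎
    where
    lemma : ∀ M e n c → M * (e * n + c) ≡ M * e * n + M * c
    lemma = solve-∀

-- Primality and the sieve.

-- `m Rough n` records that the divisors below `m` have been ruled out, so `n` is prime as soon as
-- `n < m * m`. Running out of fuel falls back on `prime?`, so the answer is correct for every
-- amount of fuel.
trialDivision : ∀ n m → .{{n>1 : NonTrivial n}} → .{{m>1 : NonTrivial m}} →
                m Rough n → (fuel : ℕ) → Dec (Prime n)
trialDivision n m rough zero = prime? n
trialDivision n m rough (suc fuel) with n <? m * m
... | yes n<m² = yes (rough∧square>⇒prime rough n<m²)
... | no  n≮m² with m ∣? n
...   | yes m∣n = no λ where (prime ¬composite) → ¬composite (composite m<n m∣n)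
  where m<n = <-≤-trans (m<m*n m m {{nonTrivial⇒nonZero m}} (nonTrivial⇒n>1 m)) (≮⇒≥ n≮m²)
...   | no  m∤n = trialDivision n (suc m)
                    {{m>1 = n>1⇒nonTrivial (m<n⇒m<1+n (nonTrivial⇒n>1 m))}}
                    (∤⇒rough-suc m∤n rough) fuel

-- prime? of the standard library tries all smaller divisors, which is too slow to compute moduli.
isPrime? : ∀ n → Dec (Prime n)
isPrime? 0        = no ¬prime[0]
isPrime? 1        = no ¬prime[1]
isPrime? n@(2+ _) = trialDivision n 2 2-rough n

modulus : ℕ → ℕ
modulus p = if p ≤ᵇ 11 then p else p * p

moduli : ℕ → List ℕ
moduli zero = []
moduli (suc k) with isPrime? (suc k)
... | yes _ = modulus (suc k) ∷ moduli k
... | no  _ = moduli k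

avoids : List ℕ → PosSet
avoids []      n = true
avoids (s ∷ L) n = not (does (s ∣? n)) ∧ avoids L n

-- Primes up to `n` suffice for testing a positive `n`: the modulus of a larger prime exceeds `n`
-- and cannot divide it. This makes the infinite sieve a decidable set.
Q : PosSet
Q n = avoids (moduli n) n

-- Arithmetic of the sieved set.

coprime-*ʳ : ∀ {m a b} → Coprime m a → Coprime m b → Coprime m (a * b)
coprime-*ʳ m⊥a m⊥b (d∣m , d∣ab) =
  m⊥b (d∣m , coprime-divisor (λ (e∣d , e∣a) → m⊥a (∣-trans e∣d d∣m , e∣a)) d∣ab)

coprime-∣ : ∀ {m n a b} → Coprime m n → a ∣ m → b ∣ n → Coprime a b
coprime-∣ m⊥n a∣m b∣n (d∣a , d∣b) = m⊥n (∣-trans d∣a a∣m , ∣-trans d∣b b∣n)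

modulus-≡ : ∀ p → modulus p ≡ p ⊎ modulus p ≡ p * p
modulus-≡ p with p ≤ᵇ 11
... | true  = inj₁ refl
... | false = inj₂ refl

modulus∣square : ∀ p → modulus p ∣ p * p
modulus∣square p with modulus-≡ p
... | inj₁ eq = subst (_∣ p * p) (sym eq) (m∣m*n p)
... | inj₂ eq = ∣-reflexive eq

modulus-square : ∀ {p} → 11 < p → modulus p ≡ p * p
modulus-square {p} 11<p with p ≤ᵇ 11 in eq
... | false = refl
... | true  = contradiction (≤ᵇ⇒≤ p 11 (subst T (sym eq) _)) (<⇒≱ 11<p)

p≤modulus : ∀ p .{{_ : NonZero p}} → p ≤ modulus p
p≤modulus p with modulus-≡ p
... | inj₁ eq = ≤-reflexive (sym eq)
... | inj₂ eq = ≤-trans (m≤m*n p p) (≤-reflexive (sym eq))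

modulus-coprime : ∀ {p q} → Coprime p q → Coprime (modulus p) (modulus q)
modulus-coprime {p} {q} p⊥q = coprime-∣ p²⊥q² (modulus∣square p) (modulus∣square q)
  where
  p⊥q² : Coprime p (q * q)
  p⊥q² = coprime-*ʳ p⊥q p⊥q
  p²⊥q² : Coprime (p * p) (q * q)
  p²⊥q² = Coprimality.sym (coprime-*ʳ (Coprimality.sym p⊥q²) (Coprimality.sym p⊥q²))

moduli-coprime : ∀ {p} → Prime p → ∀ k → k < p → All (Coprime (modulus p)) (moduli k)
moduli-coprime pp zero    _   = []
moduli-coprime pp (suc k) k<p with isPrime? (suc k)
... | yes _ = modulus-coprime (prime⇒coprime pp k<p) ∷ moduli-coprime pp k (<-trans (n<1+n k) k<p)
... | no  _ = moduli-coprime pp k (<-trans (n<1+n k) k<p)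

avoids-true : ∀ k {n} → avoids (moduli k) n ≡ true → ∀ {p} → Prime p → p ≤ k → modulus p ∤ n
avoids-true zero    h {zero} pp z≤n _ = ¬prime[0] pp
avoids-true (suc k) {n} h {p} pp p≤k with isPrime? (suc k)
... | no ¬prime[k] with m≤n⇒m<n∨m≡n p≤k
...   | inj₁ p<k  = avoids-true k h pp (≤-pred p<k)
...   | inj₂ refl = contradiction pp ¬prime[k]
avoids-true (suc k) {n} h {p} pp p≤k | yes _ with modulus (suc k) ∣? n
... | no ∤n with m≤n⇒m<n∨m≡n p≤k
...   | inj₁ p<k  = avoids-true k h pp (≤-pred p<k)
...   | inj₂ refl = ∤n

true-avoids : ∀ k {n} → (∀ {p} → Prime p → p ≤ k → modulus p ∤ n) → avoids (moduli k) n ≡ true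
true-avoids zero    _ = refl
true-avoids (suc k) {n} h with isPrime? (suc k)
... | no  _ = true-avoids k (λ pp p≤k → h pp (m≤n⇒m≤1+n p≤k))
... | yes pk with modulus (suc k) ∣? n
...   | yes ∣n = contradiction ∣n (h pk ≤-refl)
...   | no  _  = true-avoids k (λ pp p≤k → h pp (m≤n⇒m≤1+n p≤k))

Q-∤ : ∀ {n} .{{_ : NonZero n}} → Q n ≡ true → ∀ {p} → Prime p → modulus p ∤ n
Q-∤ {n} Qn {p} pp with p ≤? n
... | yes p≤n = avoids-true n Qn pp p≤n
... | no  p≰n = >⇒∤ (<-≤-trans (≰⇒> p≰n) (p≤modulus p {{prime⇒nonZero pp}}))

Q-coprime : ∀ {n p} .{{_ : NonZero n}} → Q n ≡ true → Prime p → modulus p ≡ p → Coprime n p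
Q-coprime Qn pp eq (d∣n , d∣p) with prime⇒irreducible pp d∣p
... | inj₁ d≡1  = d≡1
... | inj₂ refl = contradiction (subst (_∣ _) (sym eq) d∣n) (Q-∤ Qn pp)

primeDivisor : ∀ {n} → 1 < n → ∃[ p ] (Prime p × p ∣ n)
primeDivisor {n} 1<n with factorise n {{>-nonZero (<-trans z<s 1<n)}}
... | record { factors = [] ; isFactorisation = eq } = contradiction (sym eq) (<⇒≢ 1<n)
... | record { factors = p ∷ ps ; isFactorisation = eq ; factorsPrime = pp ∷ _ } =
  p , pp , subst (p ∣_) (sym eq) (m∣m*n _)

Q-squarefree : ∀ {n j} .{{_ : NonZero n}} → Q n ≡ true → j * j ∣ n → ¬ (1 < j)
Q-squarefree Qn j²∣n 1<j with primeDivisor 1<j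
... | p , pp , p∣j = Q-∤ Qn pp (∣-trans (modulus∣square p) (∣-trans (*-pres-∣ p∣j p∣j) j²∣n))

-- Density of the finite sieves.

∣?-* : ∀ {s r} q → Coprime r s → does (r ∣? q * s) ≡ does (r ∣? q)
∣?-* {s} {r} q r⊥s with r ∣? q * s | r ∣? q
... | yes _    | yes _   = refl
... | no  _    | no  _   = refl
... | yes r∣qs | no r∤q  = contradiction (coprime-divisor r⊥s (subst (r ∣_) (*-comm q s) r∣qs)) r∤q
... | no r∤qs  | yes r∣q = contradiction (∣m⇒∣m*n s r∣q) r∤qs

avoids-* : ∀ {s L} q → All (Coprime s) L → avoids L (q * s) ≡ avoids L q
avoids-* q []          = refl
avoids-* q (s⊥r ∷ s⊥L) =
  cong₂ (λ x y → not x ∧ y) (∣?-* q (Coprimality.sym s⊥r)) (avoids-* q s⊥L)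

-- Multiplication by `s` does not change divisibility by moduli coprime to `s`. Hence the multiples
-- of `s` that avoid `L` are exactly the `q * s` with `q` avoiding `L`.
avoids-split : ∀ {s L} → All (Coprime s) L → ∀ n →
  indicator (avoids L n) ≡ indicator (avoids (s ∷ L) n) + indicator (dilate s (avoids L) n)
avoids-split {s} {L} s⊥L n with s ∣? n
... | yes (divides q refl) = cong indicator (avoids-* q s⊥L)
... | no  _                = sym (+-identityʳ _)

count-avoids : ∀ {s L} → All (Coprime s) L → ∀ r q → r < s →
  count (avoids L) (r + q * s) ≡ count (avoids (s ∷ L)) (r + q * s) + count (avoids L) q
count-avoids {s} {L} s⊥L r q r<s = begin
  count (avoids L) (r + q * s)
    ≡⟨ count-+ {avoids L} {avoids (s ∷ L)} {dilate s (avoids L)} (λ n _ → avoids-split s⊥L n) (r + q * s) ⟩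
  count (avoids (s ∷ L)) (r + q * s) + count (dilate s (avoids L)) (r + q * s)
    ≡⟨ cong (_+_ (count (avoids (s ∷ L)) (r + q * s))) (count-dilate s (avoids L) r q r<s) ⟩
  count (avoids (s ∷ L)) (r + q * s) + count (avoids L) q ∎
  where open ≡-Reasoning

-- The density of avoids L is numerator L / denominator L when L is pairwise coprime.
numerator denominator : List ℕ → ℕ
numerator []        = 1
numerator (s ∷ L)   = numerator L * pred s
denominator []      = 1
denominator (s ∷ L) = denominator L * s

approx-avoids-∷ : ∀ {s L} .{{_ : NonZero s}} → All (Coprime s) L →
  Approx (count (avoids L)) (numerator L) (denominator L) 0 →
  Approx (count (avoids (s ∷ L))) (numerator (s ∷ L)) (denominator (s ∷ L)) 0
approx-avoids-∷ {suc s} s⊥L = approx-sieve s (count-avoids s⊥L)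

count-all : ∀ N → N ≡ count (avoids []) N
count-all zero    = refl
count-all (suc N) = trans (+-comm 1 N) (cong (_+ 1) (count-all N))

modulus-nonZero : ∀ {p} → Prime p → NonZero (modulus p)
modulus-nonZero {p} pp =
  >-nonZero (<-≤-trans (>-nonZero⁻¹ p {{prime⇒nonZero pp}}) (p≤modulus p {{prime⇒nonZero pp}}))

approx-avoids : ∀ k → Approx (count (avoids (moduli k))) (numerator (moduli k)) (denominator (moduli k)) 0
approx-avoids zero = approx-cong count-all approx-id
approx-avoids (suc k) with isPrime? (suc k)
... | yes pk = approx-avoids-∷ {{modulus-nonZero pk}} (moduli-coprime pk k ≤-refl) (approx-avoids k)
... | no  _  = approx-avoids k

-- Truncation error of the infinite sieve.

-- From 11 on the next modulus, if there is one, is the square of `suc k`, and sieving by it removes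
-- no more numbers than it has multiples up to `N`. The witness `x` bounds the loss without a
-- division.
sieve-step : ∀ N k → 11 ≤ k → ∃[ x ] (x * (suc k * suc k) ≤ N ×
  count (avoids (moduli k)) N ≤ count (avoids (moduli (suc k))) N + x)
sieve-step N k 11≤k with isPrime? (suc k)
... | no  _  = 0 , z≤n , ≤-reflexive (sym (+-identityʳ _))
... | yes pk rewrite modulus-square (s≤s 11≤k) with divMod N (suc k * suc k)
...   | r , q , r<s , refl = q , m≤n+m (q * (suc k * suc k)) r , (begin
  count (avoids (moduli k)) N′
    ≡⟨ count-avoids k⊥ r q r<s ⟩
  count (avoids (suc k * suc k ∷ moduli k)) N′ + count (avoids (moduli k)) q
    ≤⟨ +-monoʳ-≤ (count (avoids (suc k * suc k ∷ moduli k)) N′) (count≤ (avoids (moduli k)) q) ⟩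
  count (avoids (suc k * suc k ∷ moduli k)) N′ + q ∎)
  where
  N′ = r + q * (suc k * suc k)
  open ≤-Reasoning
  k⊥ : All (Coprime (suc k * suc k)) (moduli k)
  k⊥ = subst (λ s → All (Coprime s) (moduli k)) (modulus-square (s≤s 11≤k)) (moduli-coprime pk k ≤-refl)

-- Multiplied out, this is the telescoping bound ∑_{M < d ≤ M + j} N / d² ≤ N (1 / M − 1 / (M + j)).
sieve-tail : ∀ N M → 11 ≤ M → ∀ j →
  M * (j + M) * count (avoids (moduli M)) N ≤ M * (j + M) * count (avoids (moduli (j + M))) N + N * j
sieve-tail N M 11≤M zero    = m≤m+n _ _
sieve-tail N M 11≤M (suc j) with sieve-step N (j + M) (≤-trans 11≤M (m≤n+m M j))
-- The induction hypothesis has the denominator `M * k` and the goal `M * suc k`; multiplying the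
-- goal by `k` and the hypothesis by `suc k` makes them comparable.
... | x , x≤N/d² , c≤c′+x = *-cancelˡ-≤ k {{>-nonZero (≤-trans z<s (≤-trans 11≤M (m≤n+m M j)))}} (begin
  k * (M * suc k * c₀)
    ≡⟨ lemma₁ k M c₀ ⟩
  suc k * (M * k * c₀)
    ≤⟨ *-monoʳ-≤ (suc k) (sieve-tail N M 11≤M j) ⟩
  suc k * (M * k * c + N * j)
    ≤⟨ *-monoʳ-≤ (suc k) (+-monoˡ-≤ (N * j) (*-monoʳ-≤ (M * k) c≤c′+x)) ⟩
  suc k * (M * k * (c′ + x) + N * j)
    ≡⟨ lemma₂ k M c′ x N j ⟩
  k * (M * suc k * c′) + suc k * k * x * M + suc k * (N * j)
    ≤⟨ +-monoˡ-≤ (suc k * (N * j)) (+-monoʳ-≤ (k * (M * suc k * c′)) (*-monoˡ-≤ M bound)) ⟩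
  k * (M * suc k * c′) + N * M + suc k * (N * j)
    ≡⟨ lemma₃ j M c′ N ⟩
  k * (M * suc k * c′ + N * suc j) ∎)
  where
  open ≤-Reasoning
  k  = j + M
  c₀ = count (avoids (moduli M)) N
  c  = count (avoids (moduli k)) N
  c′ = count (avoids (moduli (suc k))) N
  -- One factor `suc k` is weakened to `k` because `1 / (k (k + 1)) = 1 / k − 1 / (k + 1)`
  -- telescopes.
  bound : suc k * k * x ≤ N
  bound = begin
    suc k * k * x       ≤⟨ *-monoˡ-≤ x (*-monoʳ-≤ (suc k) (n≤1+n k)) ⟩
    suc k * suc k * x   ≡⟨ *-comm (suc k * suc k) x ⟩
    x * (suc k * suc k) ≤⟨ x≤N/d² ⟩
    N                   ∎
  lemma₁ : ∀ k M c → k * (M * suc k * c) ≡ suc k * (M * k * c)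
  lemma₁ = solve-∀
  lemma₂ : ∀ k M c x N j → suc k * (M * k * (c + x) + N * j) ≡
           k * (M * suc k * c) + suc k * k * x * M + suc k * (N * j)
  lemma₂ = solve-∀
  lemma₃ : ∀ j M c N → (j + M) * (M * suc (j + M) * c) + N * M + suc (j + M) * (N * j) ≡
           (j + M) * (M * suc (j + M) * c + N * suc j)
  lemma₃ = solve-∀

Q⊆avoids : ∀ M N → count Q N ≤ count (avoids (moduli M)) N
Q⊆avoids M = count-mono {Q} {avoids (moduli M)}
  (λ n 1≤n Qn → true-avoids M (λ pp _ → Q-∤ {{>-nonZero 1≤n}} Qn pp))

count-Q : ∀ {N K} → N ≤ K → count (avoids (moduli K)) N ≤ count Q N
count-Q {N} {K} N≤K = ≤-reflexive (count-cong {avoids (moduli K)} {Q} N agree)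
  where
  agree : ∀ n → 1 ≤ n → n ≤ N → avoids (moduli K) n ≡ Q n
  agree n 1≤n n≤N with avoids (moduli K) n in eq | Q n in eq′
  ... | true  | true  = refl
  ... | false | false = refl
  ... | true  | false = trans
    (sym (true-avoids n (λ pp p≤n → avoids-true K eq pp (≤-trans p≤n (≤-trans n≤N N≤K))))) eq′
  ... | false | true  = trans
    (sym eq) (true-avoids K (λ pp _ → Q-∤ {{>-nonZero 1≤n}} eq′ pp))

-- The tail bound is used with `j = N`: up to `N`, the sieve at stage `N + M` already agrees with
-- `Q`. The loss `N * N / (M * (N + M))` is at most `N / M`.
avoids-Q : ∀ M → 11 ≤ M → ∀ N → M * count (avoids (moduli M)) N ≤ M * count Q N + N
avoids-Q M 11≤M N = *-cancelˡ-≤ (N + M) {{>-nonZero (≤-trans z<s (≤-trans 11≤M (m≤n+m M N)))}} (begin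
  (N + M) * (M * c₀)                      ≡⟨ lemma N M c₀ ⟩
  M * (N + M) * c₀                        ≤⟨ sieve-tail N M 11≤M N ⟩
  M * (N + M) * c₁ + N * N                ≤⟨ +-mono-≤ (*-monoʳ-≤ (M * (N + M)) (count-Q (m≤m+n N M)))
                                                      (*-monoʳ-≤ N (m≤m+n N M)) ⟩
  M * (N + M) * count Q N + N * (N + M)   ≡⟨ lemma′ N M (count Q N) ⟩
  (N + M) * (M * count Q N + N)           ∎)
  where
  open ≤-Reasoning
  c₀ = count (avoids (moduli M)) N
  c₁ = count (avoids (moduli (N + M))) N
  lemma : ∀ N M c → (N + M) * (M * c) ≡ M * (N + M) * c
  lemma = solve-∀
  lemma′ : ∀ N M c → M * (N + M) * c + N * (N + M) ≡ (N + M) * (M * c + N)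
  lemma′ = solve-∀

approx-Q : ∀ M → 11 ≤ M →
  Approx (count Q) (M * numerator (moduli M)) (M * denominator (moduli M)) (denominator (moduli M))
approx-Q M 11≤M = approx-subset M (Q⊆avoids M) (avoids-Q M 11≤M) (approx-avoids M)

denominator-nonZero : ∀ k → NonZero (denominator (moduli k))
denominator-nonZero zero = _
denominator-nonZero (suc k) with isPrime? (suc k)
... | yes pk = m*n≢0 _ _ {{denominator-nonZero k}} {{modulus-nonZero pk}}
... | no  _  = denominator-nonZero k

-- Union of dilates of the sieved set.

-- A common multiple of the smooth parts t.
W : ℕ
W = 2310 ^ 20

W≢0 : NonZero W
W≢0 = m^n≢0 2310 20

dilates : List ℕ → PosSet
dilates []       n = false
dilates (t ∷ ts) n = dilate t Q n ∨ dilates ts n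

coprime-^ʳ : ∀ {m a} k → Coprime m a → Coprime m (a ^ k)
coprime-^ʳ zero    m⊥a = ∣1⇒≡1 ∘ proj₂
coprime-^ʳ (suc k) m⊥a = coprime-*ʳ m⊥a (coprime-^ʳ k m⊥a)

Q-coprime-W : ∀ {m} .{{_ : NonZero m}} → Q m ≡ true → Coprime m W
Q-coprime-W Qm = coprime-^ʳ 20
  (coprime-*ʳ (Q-coprime Qm (from-yes (prime? 2)) refl)
  (coprime-*ʳ (Q-coprime Qm (from-yes (prime? 3)) refl)
  (coprime-*ʳ (Q-coprime Qm (from-yes (prime? 5)) refl)
  (coprime-*ʳ (Q-coprime Qm (from-yes (prime? 7)) refl)
              (Q-coprime Qm (from-yes (prime? 11)) refl)))))

coprime-factor-unique : ∀ {s m t n} .{{_ : NonZero s}} → s * m ≡ t * n →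
                        Coprime s n → Coprime t m → s ≡ t × m ≡ n
coprime-factor-unique {s} {m} {t} {n} sm≡tn s⊥n t⊥m = s≡t , m≡n
  where
  s≡t = ∣-antisym
    (coprime-divisor s⊥n (subst (s ∣_) (trans sm≡tn (*-comm t n)) (m∣m*n m)))
    (coprime-divisor t⊥m (subst (t ∣_) (trans (sym sm≡tn) (*-comm s m)) (m∣m*n n)))
  m≡n = *-cancelˡ-≡ m n s (trans sm≡tn (cong (_* n) (sym s≡t)))

dilates-true : ∀ ts {n} → dilates ts n ≡ true → ∃[ t ] ∃[ m ] (t ∈ ts × n ≡ m * t × Q m ≡ true)
dilates-true (t ∷ ts) {n} h with dilate t Q n in eq
... | true with dilate-true {t} Q eq
...   | m , n≡mt , Qm = t , m , here refl , n≡mt , Qm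
dilates-true (t ∷ ts) {n} h | false with dilates-true ts h
... | t′ , m , t′∈ts , n≡mt′ , Qm = t′ , m , there t′∈ts , n≡mt′ , Qm

∣W-nonZero : ∀ {t} → t ∣ W → NonZero t
∣W-nonZero {zero}  0∣W = contradiction (0∣⇒≡0 0∣W) (≢-nonZero⁻¹ W {{W≢0}})
∣W-nonZero {suc _} _   = _

factor-nonZero : ∀ {n m t} → 1 ≤ n → n ≡ m * t → NonZero m × NonZero t
factor-nonZero {n} {m} {t} 1≤n refl = m*n≢0⇒m≢0 m , m*n≢0⇒n≢0 m
  where instance _ = >-nonZero 1≤n

-- All prime factors of `s` and `t` divide 2310, while `m` and `n` are coprime to it, so the smooth
-- part can be read off from the product. Dilates of `Q` by distinct divisors of `W` are therefore
-- disjoint on the positive integers, and their counts add.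
representation-unique : ∀ {s t m n} → 1 ≤ m * s → m * s ≡ n * t → s ∣ W → t ∣ W →
                        Q m ≡ true → Q n ≡ true → s ≡ t
representation-unique {s} {t} {m} {n} 1≤ms ms≡nt s∣W t∣W Qm Qn =
  proj₁ (coprime-factor-unique {{∣W-nonZero s∣W}} (trans (*-comm s m) (trans ms≡nt (*-comm n t)))
    (Coprimality.sym (coprime-∣ (Q-coprime-W {{n≢0}} Qn) ∣-refl s∣W))
    (Coprimality.sym (coprime-∣ (Q-coprime-W {{m≢0}} Qm) ∣-refl t∣W)))
  where
  m≢0 = proj₁ (factor-nonZero {m = m} {s} 1≤ms refl)
  n≢0 = proj₁ (factor-nonZero {m = n} {t} 1≤ms ms≡nt)

dilates-split : ∀ {t ts} → t ∣ W → All (_∣ W) ts → All (t ≢_) ts → ∀ n → 1 ≤ n →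
  indicator (dilates (t ∷ ts) n) ≡ indicator (dilate t Q n) + indicator (dilates ts n)
dilates-split {t} {ts} t∣W ts∣W t∉ts n 1≤n with dilate t Q n in eq
... | false = refl
... | true with dilates ts n in eq′
...   | false = refl
...   | true with dilate-true {t} Q eq | dilates-true ts eq′
...     | m , refl , Qm | t′ , m′ , t′∈ts , mt≡m′t′ , Qm′ = contradiction
  (representation-unique {m = m} {n = m′} 1≤n mt≡m′t′ t∣W (All.lookup ts∣W t′∈ts) Qm Qm′)
  (All.lookup t∉ts t′∈ts)

-- Divided by `W`, this is the sum of the reciprocals of `ts`, the factor by which the density of
-- the union exceeds that of `Q`.
cofactorSum : ∀ {ts} → All (_∣ W) ts → ℕ
cofactorSum []           = 0
cofactorSum (t∣W ∷ ts∣W) = quotient t∣W + cofactorSum ts∣W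

approx-dilates : ∀ {a d w ts} (ts∣W : All (_∣ W) ts) → Unique ts → Approx (count Q) a d w →
  Approx (count (dilates ts)) (a * cofactorSum ts∣W) (d * W) (w * cofactorSum ts∣W)
approx-dilates {a} {d} {w} [] [] F =
  subst₂ (λ x y → Approx (count (dilates [])) x (d * W) y) (sym (*-zeroʳ a)) (sym (*-zeroʳ w))
    (approx-0 count-∅ (d * W))
approx-dilates {a} {d} {w} {t ∷ ts} (t∣W ∷ ts∣W) (t∉ts ∷ unique) F =
  subst₂ (λ x y → Approx (count (dilates (t ∷ ts))) x (d * W) y)
    (sym (*-distribˡ-+ a u (cofactorSum ts∣W))) (sym (*-distribˡ-+ w u (cofactorSum ts∣W)))
    (approx-+ (count-+ {dilates (t ∷ ts)} {dilate t Q} {dilates ts} (dilates-split t∣W ts∣W t∉ts))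
      (subst (λ x → Approx (count (dilate t Q)) (a * u) (d * x) (w * u)) (sym (m∣n⇒n≡m*quotient t∣W))
        (approx-dilate t u {{∣W-nonZero t∣W}} (count-dilate t Q) F))
      (approx-dilates ts∣W unique F))
  where u = quotient t∣W

-- Absence of geometric progressions.

-- Divisibility expresses that the ratio is an integer, and the product equation that both ratios
-- agree. Constant progressions always occur, so the conclusion is that the ratio is 1.
GPFree : List ℕ → Set
GPFree ts = ∀ {t₁ t₂ t₃} → t₁ ∈ ts → t₂ ∈ ts → t₃ ∈ ts → t₁ ∣ t₂ → t₁ * t₃ ≡ t₂ * t₂ → t₁ ≡ t₂

noGP-dilates : ∀ {ts} → All (_∣ W) ts → GPFree ts → NoGP3 (dilates ts)
noGP-dilates {ts} ts∣W gpFree a k 1≤a 2≤k (Aa , Aak , Aakk)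
  with dilates-true ts Aa | dilates-true ts Aak | dilates-true ts Aakk
... | t₁ , m₁ , t₁∈ts , refl , Qm₁ | t₂ , m₂ , t₂∈ts , eq₂ , Qm₂ | t₃ , m₃ , t₃∈ts , eq₃ , Qm₃ =
  contradiction k≡1 (>⇒≢ 2≤k)
  where
  instance
    k≢0 : NonZero k
    k≢0 = >-nonZero (<-trans z<s 2≤k)
    a≢0 : NonZero (m₁ * t₁)
    a≢0 = >-nonZero 1≤a
    ak≢0 : NonZero (m₁ * t₁ * k)
    ak≢0 = m*n≢0 (m₁ * t₁) k
    akk≢0 : NonZero (m₁ * t₁ * k * k)
    akk≢0 = m*n≢0 (m₁ * t₁ * k) k
    m₁≢0 : NonZero m₁
    m₁≢0 = proj₁ (factor-nonZero {m = m₁} {t₁} 1≤a refl)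
    m₂≢0 : NonZero m₂
    m₂≢0 = proj₁ (factor-nonZero {m = m₂} {t₂} (>-nonZero⁻¹ _) eq₂)
    m₃≢0 : NonZero m₃
    m₃≢0 = proj₁ (factor-nonZero {m = m₃} {t₃} (>-nonZero⁻¹ _) eq₃)
    t₂≢0 : NonZero t₂
    t₂≢0 = proj₂ (factor-nonZero {m = m₂} {t₂} (>-nonZero⁻¹ _) eq₂)
    t₃≢0 : NonZero t₃
    t₃≢0 = proj₂ (factor-nonZero {m = m₃} {t₃} (>-nonZero⁻¹ _) eq₃)

  t⊥m : ∀ {t m} .{{_ : NonZero m}} → t ∈ ts → Q m ≡ true → Coprime t m
  t⊥m t∈ts Qm = Coprimality.sym (coprime-∣ (Q-coprime-W Qm) ∣-refl (All.lookup ts∣W t∈ts))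

  t₁∣t₂ : t₁ ∣ t₂
  t₁∣t₂ = coprime-divisor (t⊥m t₁∈ts Qm₂) (subst (t₁ ∣_) eq₂ (∣m⇒∣m*n k (n∣m*n m₁)))
  m₁∣m₂ : m₁ ∣ m₂
  m₁∣m₂ = coprime-divisor (Coprimality.sym (t⊥m t₂∈ts Qm₁))
    (subst (m₁ ∣_) (trans eq₂ (*-comm m₂ t₂)) (∣m⇒∣m*n k (m∣m*n t₁)))

  -- The ratio `k` splits into `i`, the ratio of the smooth parts, and `j`, the ratio of the sieved
  -- parts.
  i = quotient t₁∣t₂
  j = quotient m₁∣m₂
  t₂≡ : t₂ ≡ i * t₁
  t₂≡ = m∣n⇒n≡quotient*m t₁∣t₂
  m₂≡ : m₂ ≡ j * m₁
  m₂≡ = m∣n⇒n≡quotient*m m₁∣m₂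

  k≡ij : k ≡ i * j
  k≡ij = *-cancelˡ-≡ k (i * j) (m₁ * t₁) (begin
    m₁ * t₁ * k         ≡⟨ eq₂ ⟩
    m₂ * t₂             ≡⟨ cong₂ _*_ m₂≡ t₂≡ ⟩
    j * m₁ * (i * t₁)   ≡⟨ lemma i j m₁ t₁ ⟩
    m₁ * t₁ * (i * j)   ∎)
    where
    open ≡-Reasoning
    lemma : ∀ i j m t → j * m * (i * t) ≡ m * t * (i * j)
    lemma = solve-∀

  third : t₃ * m₃ ≡ t₂ * i * (m₂ * j)
  third = begin
    t₃ * m₃             ≡⟨ *-comm t₃ m₃ ⟩
    m₃ * t₃             ≡⟨ eq₃ ⟨
    m₁ * t₁ * k * k     ≡⟨ cong₂ _*_ eq₂ k≡ij ⟩
    m₂ * t₂ * (i * j)   ≡⟨ lemma i j m₂ t₂ ⟩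
    t₂ * i * (m₂ * j)   ∎
    where
    open ≡-Reasoning
    lemma : ∀ i j m t → m * t * (i * j) ≡ t * i * (m * j)
    lemma = solve-∀

  -- Splitting the third term needs `t₃` coprime to `m₂ * j` and `t₂ * i` coprime to `m₃`. Both hold
  -- since `j` divides `m₂` and `i` divides `t₂`.
  factors : t₃ ≡ t₂ * i × m₃ ≡ m₂ * j
  factors = coprime-factor-unique third
    (coprime-*ʳ (t⊥m t₃∈ts Qm₂) (coprime-∣ (t⊥m t₃∈ts Qm₂) ∣-refl (quotient-∣ m₁∣m₂)))
    (Coprimality.sym (coprime-*ʳ (Coprimality.sym (t⊥m t₂∈ts Qm₃))
      (coprime-∣ (Coprimality.sym (t⊥m t₂∈ts Qm₃)) ∣-refl (quotient-∣ t₁∣t₂))))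

  j²∣m₃ : j * j ∣ m₃
  j²∣m₃ = subst (j * j ∣_) (sym (proj₂ factors)) (*-monoˡ-∣ j (quotient-∣ m₁∣m₂))

  j≡1 : j ≡ 1
  j≡1 = ≤-antisym (≮⇒≥ (Q-squarefree Qm₃ j²∣m₃))
    (>-nonZero⁻¹ j {{quotient≢0 m₁∣m₂}})

  t₁≡t₂ : t₁ ≡ t₂
  t₁≡t₂ = gpFree t₁∈ts t₂∈ts t₃∈ts t₁∣t₂ (begin
    t₁ * t₃        ≡⟨ cong (t₁ *_) (proj₁ factors) ⟩
    t₁ * (t₂ * i)  ≡⟨ lemma t₁ t₂ i ⟩
    t₂ * (i * t₁)  ≡⟨ cong (t₂ *_) t₂≡ ⟨
    t₂ * t₂        ∎)
    where
    open ≡-Reasoning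
    lemma : ∀ s t i → s * (t * i) ≡ t * (i * s)
    lemma = solve-∀

  i≡1 : i ≡ 1
  i≡1 = *-cancelʳ-≡ i 1 t₂ (begin
    i * t₂   ≡⟨ cong (i *_) t₁≡t₂ ⟨
    i * t₁   ≡⟨ t₂≡ ⟨
    t₂       ≡⟨ *-identityˡ t₂ ⟨
    1 * t₂   ∎)
    where open ≡-Reasoning

  k≡1 : k ≡ 1
  k≡1 = trans k≡ij (cong₂ _*_ i≡1 j≡1)

-- A Boolean test, since evaluating a nested Dec over all triples exhausts memory.
noGPᵇ : List ℕ → ℕ → ℕ → Bool
noGPᵇ ts t₁ t₂ = (t₁ ≡ᵇ t₂) ∨ (not (does (t₁ ∣? t₂)) ∨ all (λ t₃ → not (t₁ * t₃ ≡ᵇ t₂ * t₂)) ts)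

gpFreeᵇ : List ℕ → Bool
gpFreeᵇ ts = all (λ t₁ → all (noGPᵇ ts t₁) ts) ts

gpFreeᵇ⇒GPFree : ∀ ts → T (gpFreeᵇ ts) → GPFree ts
gpFreeᵇ⇒GPFree ts h {t₁} {t₂} {t₃} t₁∈ts t₂∈ts t₃∈ts t₁∣t₂ t₁t₃≡t₂²
  with Equivalence.to (T-∨ {t₁ ≡ᵇ t₂})
         (All.lookup (all⁺ (noGPᵇ ts t₁) ts (All.lookup (all⁺ _ ts h) t₁∈ts)) t₂∈ts)
... | inj₁ t₁≡t₂ = ≡ᵇ⇒≡ t₁ t₂ t₁≡t₂
... | inj₂ h′ with t₁ ∣? t₂
...   | no t₁∤t₂ = contradiction t₁∣t₂ t₁∤t₂
...   | yes _ = contradiction (≡⇒≡ᵇ _ _ t₁t₃≡t₂²) (¬T (All.lookup (all⁺ _ ts h′) t₃∈ts))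
  where
  ¬T : ∀ {b} → T (not b) → ¬ T b
  ¬T {false} _ ()

-- From integer bounds to rational densities.

/-mono-≤ : ∀ x m y n → x * suc n ≤ y * suc m → (+ x) / suc m ≤ℚ (+ y) / suc n
/-mono-≤ x m y n xn≤ym = ℚ.toℚᵘ-cancel-≤ (begin
  toℚᵘ ((+ x) / suc m)   ≃⟨ ℚ.toℚᵘ-fromℚᵘ (mkℚᵘ (+ x) m) ⟩
  mkℚᵘ (+ x) m            ≤⟨ *≤* (subst₂ ℤ._≤_ (ℤ.pos-* x (suc n)) (ℤ.pos-* y (suc m)) (ℤ.+≤+ xn≤ym)) ⟩
  mkℚᵘ (+ y) n            ≃⟨ ℚ.toℚᵘ-fromℚᵘ (mkℚᵘ (+ y) n) ⟨
  toℚᵘ ((+ y) / suc n)   ∎)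
  where open ℚᵘ.≤-Reasoning

-- The summand appears as `mkℚ (+ p) q`, the form that matching on a positive `ε` produces.
-- Unnormalised rationals reduce the claim to cross-multiplication.
/-≤-+ : ∀ x m y n p q .(coprime : Coprime p (suc q)) →
        x * (suc n * suc q) ≤ (y * suc q + p * suc n) * suc m →
        (+ x) / suc m ≤ℚ (+ y) / suc n +ℚ mkℚ (+ p) q coprime
/-≤-+ x m y n p q coprime h = ℚ.toℚᵘ-cancel-≤ (begin
  toℚᵘ ((+ x) / suc m)                   ≃⟨ ℚ.toℚᵘ-fromℚᵘ (mkℚᵘ (+ x) m) ⟩
  mkℚᵘ (+ x) m                            ≤⟨ *≤* (subst₂ ℤ._≤_ (ℤ.pos-* x _) rhs (ℤ.+≤+ h)) ⟩
  mkℚᵘ (+ y) n ℚᵘ.+ mkℚᵘ (+ p) q          ≃⟨ ℚᵘ.+-congˡ (mkℚᵘ (+ p) q) (ℚ.toℚᵘ-fromℚᵘ (mkℚᵘ (+ y) n)) ⟨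
  toℚᵘ ((+ y) / suc n) ℚᵘ.+ mkℚᵘ (+ p) q ≃⟨ ℚ.toℚᵘ-homo-+ ((+ y) / suc n) (mkℚ (+ p) q coprime) ⟨
  toℚᵘ ((+ y) / suc n +ℚ mkℚ (+ p) q coprime) ∎)
  where
  open ℚᵘ.≤-Reasoning
  rhs : + ((y * suc q + p * suc n) * suc m) ≡ ((+ y) ℤ.* (+ suc q) ℤ.+ (+ p) ℤ.* (+ suc n)) ℤ.* (+ suc m)
  rhs = trans (ℤ.pos-* (y * suc q + p * suc n) (suc m))
    (cong (ℤ._* (+ suc m)) (trans (ℤ.pos-+ (y * suc q) (p * suc n))
      (cong₂ ℤ._+_ (ℤ.pos-* y (suc q)) (ℤ.pos-* p (suc n)))))

≤-+⇒-≤ : ∀ r s ε → r ≤ℚ s +ℚ ε → r -ℚ s ≤ℚ ε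
≤-+⇒-≤ r s ε r≤s+ε = begin
  r -ℚ s              ≤⟨ ℚ.+-monoˡ-≤ (-ℚ s) r≤s+ε ⟩
  s +ℚ ε +ℚ -ℚ s      ≡⟨ cong (_+ℚ -ℚ s) (ℚ.+-comm s ε) ⟩
  ε +ℚ s +ℚ -ℚ s      ≡⟨ ℚ.+-assoc ε s (-ℚ s) ⟩
  ε +ℚ (s -ℚ s)       ≡⟨ cong (ε +ℚ_) (ℚ.+-inverseʳ s) ⟩
  ε +ℚ 0ℚ             ≡⟨ ℚ.+-identityʳ ε ⟩
  ε                   ∎
  where open ℚ.≤-Reasoning

∣-∣-≤ : ∀ r s ε → r ≤ℚ s +ℚ ε → s ≤ℚ r +ℚ ε → ∣ r -ℚ s ∣ ≤ℚ ε
∣-∣-≤ r s ε r≤s+ε s≤r+ε with ℚ.∣p∣≡p∨∣p∣≡-p (r -ℚ s)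
... | inj₁ eq = subst (_≤ℚ ε) (sym eq) (≤-+⇒-≤ r s ε r≤s+ε)
... | inj₂ eq = subst (_≤ℚ ε) (sym (trans eq -[r-s])) (≤-+⇒-≤ s r ε s≤r+ε)
  where
  -[r-s] : -ℚ (r -ℚ s) ≡ s -ℚ r
  -[r-s] = begin
    -ℚ (r +ℚ -ℚ s)       ≡⟨ ℚ.neg-distrib-+ r (-ℚ s) ⟩
    -ℚ r +ℚ -ℚ (-ℚ s)    ≡⟨ cong (-ℚ r +ℚ_) (neg-involutive s) ⟩
    -ℚ r +ℚ s            ≡⟨ ℚ.+-comm (-ℚ r) s ⟩
    s -ℚ r               ∎
    where
    open ≡-Reasoning
    open import Algebra.Properties.Group ℚ.+-0-group using () renaming (⁻¹-involutive to neg-involutive)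

-- Cross-multiplied form of `f m / m ≤ f n / n + p / q`. The error is `w / d ≤ 1 / (2q)` from the
-- gap between the bounds, plus at most `1 / (4q)` from the constant `c` at each of `m` and `n`. The
-- total is at most `1 / q`, hence at most `p / q`.
approx-close : ∀ {f a d w} .{{_ : NonZero d}} (F : Approx f a d w) p q .{{_ : NonZero p}} →
  2 * q * w ≤ d → ∀ m n → 4 * q * Approx.c F ≤ m → 4 * q * Approx.c F ≤ n →
  f m * (n * q) ≤ (f n * q + p * n) * m
approx-close {f} {a} {d} {w} F p q 2qw≤d m n 4qc≤m 4qc≤n =
  *-cancelˡ-≤ (4 * d) {{m*n≢0 4 d}} (begin
    4 * d * (f m * (n * q))
      ≡⟨ lemma₁ d (f m) n q ⟩
    4 * q * n * (d * f m)
      ≤⟨ *-monoʳ-≤ (4 * q * n) (upper m) ⟩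
    4 * q * n * (a * m + c)
      ≡⟨ lemma₂ a c m n q ⟩
    4 * q * m * (a * n) + 4 * q * c * n
      ≤⟨ +-monoˡ-≤ (4 * q * c * n) (*-monoʳ-≤ (4 * q * m) (lower n)) ⟩
    4 * q * m * (d * f n + (w * n + c)) + 4 * q * c * n
      ≡⟨ lemma₃ d w c m n q (f n) ⟩
    4 * d * q * m * f n + (2 * q * w * (2 * m * n) + 4 * q * c * m + 4 * q * c * n)
      ≤⟨ +-monoʳ-≤ (4 * d * q * m * f n) (+-mono-≤ (+-mono-≤ (*-monoˡ-≤ (2 * m * n) 2qw≤d)
           (*-monoˡ-≤ m (≤-trans 4qc≤n (m≤n*m n d)))) (*-monoˡ-≤ n (≤-trans 4qc≤m (m≤n*m m d)))) ⟩
    4 * d * q * m * f n + (d * (2 * m * n) + d * n * m + d * m * n)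
      ≡⟨ lemma₄ d m n (4 * d * q * m * f n) ⟩
    4 * d * q * m * f n + 4 * d * m * n
      ≤⟨ +-monoʳ-≤ (4 * d * q * m * f n) (m≤n*m (4 * d * m * n) p) ⟩
    4 * d * q * m * f n + p * (4 * d * m * n)
      ≡⟨ lemma₅ d m n p q (f n) ⟩
    4 * d * ((f n * q + p * n) * m) ∎)
  where
  open Approx F
  open ≤-Reasoning
  lemma₁ : ∀ d x n q → 4 * d * (x * (n * q)) ≡ 4 * q * n * (d * x)
  lemma₁ = solve-∀
  lemma₂ : ∀ a c m n q → 4 * q * n * (a * m + c) ≡ 4 * q * m * (a * n) + 4 * q * c * n
  lemma₂ = solve-∀
  lemma₃ : ∀ d w c m n q y → 4 * q * m * (d * y + (w * n + c)) + 4 * q * c * n ≡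
           4 * d * q * m * y + (2 * q * w * (2 * m * n) + 4 * q * c * m + 4 * q * c * n)
  lemma₃ = solve-∀
  lemma₄ : ∀ d m n z → z + (d * (2 * m * n) + d * n * m + d * m * n) ≡ z + 4 * d * m * n
  lemma₄ = solve-∀
  lemma₅ : ∀ d m n p q y → 4 * d * q * m * y + p * (4 * d * m * n) ≡ 4 * d * ((y * q + p * n) * m)
  lemma₅ = solve-∀

-- A single approximation with positive `w` only confines the ratios to an interval of length about
-- `w / d`. The Cauchy property needs approximations with this length arbitrarily small.
approx⇒densityExists : ∀ {A} →
  (∀ q → ∃[ a ] ∃[ d ] ∃[ w ] (Approx (count A) a d w × NonZero d × 2 * q * w ≤ d)) →
  DensityExists A
approx⇒densityExists approx (mkℚ (+ zero) q _) 0<ε with () ← ℤ.drop‿+<+ (ℚ.drop-*<* 0<ε)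
approx⇒densityExists approx (mkℚ -[1+ p ] q _) 0<ε with () ← ℚ.drop-*<* 0<ε
approx⇒densityExists {A} approx ε@(mkℚ +[1+ p ] q coprime) 0<ε with approx (suc q)
... | a , d , w , F , d≢0 , 2qw≤d = N₀ , λ m n N₀≤m N₀≤n →
  ∣-∣-≤ (ratio A m) (ratio A n) ε (close m n N₀≤m N₀≤n) (close n m N₀≤n N₀≤m)
  where
  N₀ = 4 * suc q * Approx.c F
  close : ∀ m n → N₀ ≤ m → N₀ ≤ n → ratio A m ≤ℚ ratio A n +ℚ ε
  close m n N₀≤m N₀≤n = /-≤-+ (count A (suc m)) m (count A (suc n)) n (suc p) q coprime
    (approx-close {{d≢0}} F (suc p) (suc q) 2qw≤d (suc m) (suc n) (m≤n⇒m≤1+n N₀≤m) (m≤n⇒m≤1+n N₀≤n))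

-- The hypothesis says that `s / 100000` lies below the lower density bound `(a − w) / d`. As a
-- strict inequality of integers it leaves a spare `N` after multiplication by `N`, which absorbs
-- `100000 * c` once `N` is that large.
approx⇒densityGreaterThan : ∀ {A a d w} .{{_ : NonZero d}} → Approx (count A) a d w → ∀ r s →
  r <ℚ (+ s) / 100000 → s * d + 100000 * w < 100000 * a → DensityGreaterThan A r
approx⇒densityGreaterThan {A} {a} {d} {w} F r s r<s h =
  (+ s) / 100000 , r<s , 100000 * c , λ n N₀≤n → /-mono-≤ s 99999 (count A (suc n)) n
    (*-cancelˡ-≤ d (+-cancelʳ-≤ (suc n) _ _ (bound (suc n) (m≤n⇒m≤1+n N₀≤n))))
  where
  open Approx F
  open ≤-Reasoning
  bound : ∀ N → 100000 * c ≤ N → d * (s * N) + N ≤ d * (count A N * 100000) + N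
  bound N 100000c≤N = +-cancelʳ-≤ (100000 * w * N) _ _ (begin
    d * (s * N) + N + 100000 * w * N
      ≡⟨ lemma₁ 100000 d s N w ⟩
    suc (s * d + 100000 * w) * N
      ≤⟨ *-monoˡ-≤ N h ⟩
    100000 * a * N
      ≡⟨ *-assoc 100000 a N ⟩
    100000 * (a * N)
      ≤⟨ *-monoʳ-≤ 100000 (lower N) ⟩
    100000 * (d * count A N + (w * N + c))
      ≡⟨ lemma₂ 100000 d w c N (count A N) ⟩
    d * (count A N * 100000) + 100000 * c + 100000 * w * N
      ≤⟨ +-monoˡ-≤ (100000 * w * N) (+-monoʳ-≤ (d * (count A N * 100000)) 100000c≤N) ⟩
    d * (count A N * 100000) + N + 100000 * w * N ∎)
    where
    lemma₁ : ∀ k d s N w → d * (s * N) + N + k * w * N ≡ suc (s * d + k * w) * N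
    lemma₁ = solve-∀
    lemma₂ : ∀ k d w c N x → k * (d * x + (w * N + c)) ≡ d * (x * k) + k * c + k * w * N
    lemma₂ = solve-∀

-- The explicit set and its density.

-- The 11-smooth numbers up to 50000, chosen greedily in increasing order after leaving out
-- 9, 30, 42, 50, 66, 70, 105, 192 and 275, an exclusion list found by local search.
smoothSet : List ℕ
smoothSet =
  1 ∷ 2 ∷ 3 ∷ 5 ∷ 6 ∷ 7 ∷ 8 ∷ 10 ∷ 11 ∷ 14 ∷ 15 ∷ 16 ∷ 21 ∷ 22 ∷ 24 ∷ 27 ∷ 33 ∷ 35 ∷ 40 ∷
  48 ∷ 54 ∷ 55 ∷ 56 ∷ 60 ∷ 77 ∷ 80 ∷ 81 ∷ 84 ∷ 88 ∷ 90 ∷ 110 ∷ 112 ∷ 120 ∷ 125 ∷ 126 ∷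
  132 ∷ 135 ∷ 140 ∷ 150 ∷ 154 ∷ 162 ∷ 165 ∷ 168 ∷ 176 ∷ 180 ∷ 189 ∷ 198 ∷ 210 ∷ 216 ∷
  231 ∷ 250 ∷ 252 ∷ 264 ∷ 270 ∷ 280 ∷ 294 ∷ 297 ∷ 300 ∷ 315 ∷ 330 ∷ 343 ∷ 350 ∷ 375 ∷
  378 ∷ 385 ∷ 396 ∷ 405 ∷ 420 ∷ 432 ∷ 440 ∷ 450 ∷ 462 ∷ 480 ∷ 490 ∷ 512 ∷ 525 ∷ 567 ∷
  588 ∷ 594 ∷ 616 ∷ 625 ∷ 630 ∷ 648 ∷ 672 ∷ 686 ∷ 700 ∷ 726 ∷ 735 ∷ 750 ∷ 770 ∷ 875 ∷
  880 ∷ 882 ∷ 891 ∷ 900 ∷ 945 ∷ 980 ∷ 1000 ∷ 1024 ∷ 1029 ∷ 1050 ∷ 1056 ∷ 1080 ∷ 1120 ∷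
  1155 ∷ 1232 ∷ 1250 ∷ 1296 ∷ 1320 ∷ 1331 ∷ 1375 ∷ 1452 ∷ 1470 ∷ 1485 ∷ 1512 ∷ 1536 ∷
  1575 ∷ 1650 ∷ 1680 ∷ 1715 ∷ 1750 ∷ 1764 ∷ 1848 ∷ 1875 ∷ 2000 ∷ 2058 ∷ 2079 ∷ 2178 ∷
  2205 ∷ 2310 ∷ 2376 ∷ 2401 ∷ 2430 ∷ 2450 ∷ 2520 ∷ 2560 ∷ 2625 ∷ 2640 ∷ 2662 ∷ 2744 ∷
  2750 ∷ 2970 ∷ 3000 ∷ 3072 ∷ 3080 ∷ 3234 ∷ 3360 ∷ 3375 ∷ 3402 ∷ 3430 ∷ 3584 ∷ 3630 ∷
  3675 ∷ 3696 ∷ 3773 ∷ 3780 ∷ 3993 ∷ 4096 ∷ 4125 ∷ 4158 ∷ 4200 ∷ 4356 ∷ 4375 ∷ 4455 ∷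
  4802 ∷ 4900 ∷ 5000 ∷ 5082 ∷ 5120 ∷ 5145 ∷ 5346 ∷ 5488 ∷ 5632 ∷ 5670 ∷ 5880 ∷ 6160 ∷
  6237 ∷ 6655 ∷ 6750 ∷ 6875 ∷ 7000 ∷ 7168 ∷ 7203 ∷ 7546 ∷ 7560 ∷ 7680 ∷ 7986 ∷ 8192 ∷
  8232 ∷ 8470 ∷ 8505 ∷ 8910 ∷ 9240 ∷ 9261 ∷ 9317 ∷ 9450 ∷ 9625 ∷ 10000 ∷ 10125 ∷ 10395 ∷
  10500 ∷ 10648 ∷ 10752 ∷ 11000 ∷ 11025 ∷ 11264 ∷ 11319 ∷ 11520 ∷ 11880 ∷ 12005 ∷ 12288 ∷
  12474 ∷ 12705 ∷ 13230 ∷ 13310 ∷ 13720 ∷ 13750 ∷ 13824 ∷ 14641 ∷ 15750 ∷ 16128 ∷ 16632 ∷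
  16875 ∷ 16896 ∷ 17010 ∷ 17280 ∷ 17920 ∷ 18480 ∷ 18522 ∷ 18634 ∷ 18750 ∷ 18865 ∷ 19200 ∷
  19208 ∷ 19250 ∷ 19683 ∷ 19965 ∷ 20480 ∷ 20580 ∷ 20625 ∷ 20790 ∷ 21000 ∷ 21296 ∷ 22000 ∷
  23625 ∷ 23760 ∷ 24192 ∷ 24576 ∷ 25344 ∷ 25920 ∷ 26250 ∷ 26411 ∷ 27000 ∷ 27648 ∷ 27783 ∷
  27951 ∷ 28160 ∷ 28672 ∷ 28875 ∷ 29282 ∷ 30184 ∷ 30720 ∷ 30870 ∷ 31185 ∷ 31944 ∷ 33000 ∷
  33264 ∷ 34560 ∷ 35640 ∷ 35937 ∷ 36288 ∷ 36750 ∷ 37125 ∷ 37632 ∷ 37730 ∷ 38016 ∷ 38416 ∷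
  38880 ∷ 39366 ∷ 39424 ∷ 40960 ∷ 41160 ∷ 41250 ∷ 41472 ∷ 42875 ∷ 43008 ∷ 43750 ∷ 43923 ∷
  44800 ∷ 45056 ∷ 46305 ∷ 46585 ∷ 47250 ∷ 48000 ∷ 48125 ∷ 48384 ∷ 49896 ∷ []

smoothSet∣W : All (_∣ W) smoothSet
smoothSet∣W = from-yes (all? (_∣? W) smoothSet)

smoothSet-unique : Unique smoothSet
smoothSet-unique = from-yes (unique? smoothSet)

smoothSet-gpFree : GPFree smoothSet
smoothSet-gpFree = gpFreeᵇ⇒GPFree smoothSet _

-- The truncation point `M` stays a parameter: existence of the density needs it arbitrarily large,
-- the numerical bound needs one fixed value.
module Approximation (M : ℕ) (11≤M : 11 ≤ M) where
  D S a d w : ℕ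
  D = denominator (moduli M)
  S = cofactorSum smoothSet∣W
  a = M * numerator (moduli M) * S
  d = M * D * W
  w = D * S

  approx : Approx (count (dilates smoothSet)) a d w
  approx = approx-dilates smoothSet∣W smoothSet-unique (approx-Q M 11≤M)

  d≢0 : NonZero d
  d≢0 = m*n≢0 (M * D) W {{m*n≢0 M D {{>-nonZero (≤-trans z<s 11≤M)}} {{denominator-nonZero M}}}} {{W≢0}}

smoothSet-density : ∀ q → ∃[ a ] ∃[ d ] ∃[ w ]
  (Approx (count (dilates smoothSet)) a d w × NonZero d × 2 * q * w ≤ d)
smoothSet-density q = a , d , w , approx , d≢0 , (begin
  2 * q * (D * S)   ≡⟨ lemma q D S ⟩
  2 * q * S * D     ≤⟨ *-monoˡ-≤ D (m≤n+m (2 * q * S) 11) ⟩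
  M * D             ≤⟨ m≤m*n (M * D) W {{W≢0}} ⟩
  M * D * W         ∎)
  where
  open ≤-Reasoning
  -- Here `w / d` is `S / (M * W)`, so `M ≥ 2 * q * S` is enough; the summand 11 ensures that all
  -- later moduli are squares.
  M = 11 + 2 * q * cofactorSum smoothSet∣W
  open Approximation M (m≤m+n 11 _)
  lemma : ∀ q D S → 2 * q * (D * S) ≡ 2 * q * S * D
  lemma = solve-∀

-- The density is about 0.72246, and truncating the sieve at M loses about 3.56 / M.
module At10000 = Approximation 10000 (from-yes (11 ≤? 10000))

-- A rational strictly above 0.72195 is required, hence 72196. The margin suffices: 0.72246 less
-- about 0.00036 is about 0.7221.
numerical : 72196 * At10000.d + 100000 * At10000.w < 100000 * At10000.a
numerical = <ᵇ⇒< (72196 * At10000.d + 100000 * At10000.w) (100000 * At10000.a) _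

theorem3p2 : ∃[ A ] (NoGP3 A × DensityExists A × DensityGreaterThan A ((+ 72195) / 100000))
theorem3p2 =
  dilates smoothSet ,
  noGP-dilates smoothSet∣W smoothSet-gpFree ,
  approx⇒densityExists smoothSet-density ,
  approx⇒densityGreaterThan {{At10000.d≢0}} At10000.approx ((+ 72195) / 100000) 72196
    (from-yes ((+ 72195) / 100000 ℚ.<? (+ 72196) / 100000)) numerical
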